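{- $\mathsf{EPF} \to \mathsf{EA}$. That is: given $e : \mathbb{N} \to (\mathbb{N} \rightharpoonup \mathbb{N})$ such that for every partial function $f : \mathbb{N} \rightharpoonup \mathbb{N}$ there exists $n$ with $e\,n \equiv_{\mathbb{N} \rightharpoonup \mathbb{N}} f$, one can construct $\varphi : \mathbb{N} \to (\mathbb{N} \to \mathrm{option}\,\mathbb{N})$ such that for every $f : \mathbb{N} \to \mathrm{option}\,\mathbb{N}$ there exists $c$ with $\varphi\,c \equiv_{\mathsf{ran}} f$.
   Context: Ambient theory: Coq's type theory (constructive, with a hierarchy of types $\mathbb{T}$ and a separate impredicative universe $\mathbb{P}$ of propositions), with no additional axioms. $\exists$ is propositional existence, $\Sigma$ the dependent pair type. Partial values: one assumes a type $\partial A$ for each type $A$, with a definedness relation $\triangleright : \partial A \to A \to \mathbb{P}$ satisfying $x \triangleright a_1 \to x \triangleright a_2 \to a_1 = a_2$, and operations: $\mathsf{ret} : A \to \partial A$ with $\mathsf{ret}\,a \triangleright a$; $\mathsf{undef} : \partial A$ with $\neg\exists a.\ \mathsf{undef} \triangleright a$; bind $\gg\!= \,: \partial A \to (A \to \partial B) \to \partial B$ with $(x \gg\!= f) \triangleright b \leftrightarrow \exists a.\ x \triangleright a \land f\,a \triangleright b$; $\mu : (\mathbb{N} \to \mathbb{B}) \to \partial \mathbb{N}$ with $\mu f \triangleright n \leftrightarrow f\,n = \mathsf{true} \land \forall m < n.\ f\,m = \mathsf{false}$; $\mathsf{seval} : \partial A \to \mathbb{N} \to \mathrm{option}\,A$ with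 $x \triangleright a \leftrightarrow \exists n.\ \mathsf{seval}\,x\,n = \mathrm{Some}\,a$. Write $A \rightharpoonup B$ for $A \to \partial B$, and $f \equiv_{A \rightharpoonup B} g := \forall x.\,\forall b.\ f\,x \triangleright b \leftrightarrow g\,x \triangleright b$. $\mathsf{EPF} := \Sigma e : \mathbb{N} \to (\mathbb{N} \rightharpoonup \mathbb{N}).\ \forall f : \mathbb{N} \rightharpoonup \mathbb{N}.\ \exists n.\ e\,n \equiv_{\mathbb{N} \rightharpoonup \mathbb{N}} f$. Range equivalence of $f, g : \mathbb{N} \to \mathrm{option}\,\mathbb{N}$: $f \equiv_{\mathsf{ran}} g := \forall x.\ (\exists n.\ f\,n = \mathrm{Some}\,x) \leftrightarrow (\exists n.\ g\,n = \mathrm{Some}\,x)$. $\mathsf{EA} := \Sigma \varphi : \mathbb{N} \to (\mathbb{N} \to \mathrm{option}\,\mathbb{N}).\ \forall f : \mathbb{N} \to \mathrm{option}\,\mathbb{N}.\ \exists c.\ \varphi\,c \equiv_{\mathsf{ran}} f$. -}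

module Defs where

open import Data.Bool using (Bool; true; false)
open import Data.Empty using (⊥)
open import Data.Maybe using (Maybe; just)
open import Data.Nat using (ℕ; _<_)
open import Data.Product using (Σ; _×_; _,_; uncurry)
open import Data.Unit.Polymorphic using (⊤; tt)
open import Function.Bundles using (_⇔_)
open import Relation.Binary.PropositionalEquality using (_≡_)
open import Relation.Nullary using (¬_)

-- Coq's sort of propositions, as a subclass `IsProp` of the small types.
-- The point of it is the propositional existential `∃`, which, unlike Σ, can
-- only be eliminated into propositions: no witness can be extracted from it
-- in order to construct data.  The other connectives are those of Agda, and
-- propositions are closed under them.  `IsProp` is membership in the sort; it
-- does not mean proof irrelevance, which Coq does not assume either.
record Propositions : Set₂ where
  field
    IsProp  : Set → Set₁
    ⊥-prop  : IsProp ⊥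
    ≡-prop  : {A : Set} {x y : A} → IsProp (x ≡ y)
    Π-prop  : {A : Set} {B : A → Set} → (∀ x → IsProp (B x)) → IsProp (∀ x → B x)
    ×-prop  : {A B : Set} → IsProp A → IsProp B → IsProp (A × B)
    ⇔-prop  : {A B : Set} → IsProp A → IsProp B → IsProp (A ⇔ B)

    ∃       : {A : Set} → (A → Set) → Set
    ∃-prop  : {A : Set} {P : A → Set} → IsProp (∃ P)
    ∃-intro : {A : Set} {P : A → Set} (x : A) → P x → ∃ P
    ∃-elim  : {A : Set} {P : A → Set} {Q : Set} → IsProp Q →
              (∀ x → P x → Q) → ∃ P → Q

-- The reading of ∃ as Σ is one instance among others.
typesAsPropositions : Propositions
typesAsPropositions = record
  { IsProp  = λ _ → ⊤
  ; ⊥-prop  = tt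
  ; ≡-prop  = tt
  ; Π-prop  = λ _ → tt
  ; ×-prop  = λ _ _ → tt
  ; ⇔-prop  = λ _ _ → tt
  ; ∃       = Σ _
  ; ∃-prop  = tt
  ; ∃-intro = _,_
  ; ∃-elim  = λ _ → uncurry
  }

module _ (𝓟 : Propositions) where
  open Propositions 𝓟

  record Partiality : Set₁ where
    infix  4 _▹_
    infixl 1 _>>=_
    field
      ∂      : Set → Set
      _▹_    : {A : Set} → ∂ A → A → Set
      ▹-prop : {A : Set} {x : ∂ A} {a : A} → IsProp (x ▹ a)
      ▹-functional : {A : Set} {x : ∂ A} {a₁ a₂ : A} → x ▹ a₁ → x ▹ a₂ → a₁ ≡ a₂

      ret    : {A : Set} → A → ∂ A
      ret-▹  : {A : Set} {a : A} → ret a ▹ a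

      undef   : {A : Set} → ∂ A
      undef-▹ : {A : Set} → ¬ ∃ λ (a : A) → undef ▹ a

      _>>=_ : {A B : Set} → ∂ A → (A → ∂ B) → ∂ B
      >>=-▹ : {A B : Set} {x : ∂ A} {f : A → ∂ B} {b : B} →
              (x >>= f) ▹ b ⇔ ∃ λ a → x ▹ a × f a ▹ b

      μ   : (ℕ → Bool) → ∂ ℕ
      μ-▹ : {f : ℕ → Bool} {n : ℕ} →
            μ f ▹ n ⇔ (f n ≡ true × (∀ m → m < n → f m ≡ false))

      seval   : {A : Set} → ∂ A → ℕ → Maybe A
      seval-▹ : {A : Set} {x : ∂ A} {a : A} →
                x ▹ a ⇔ ∃ λ n → seval x n ≡ just a

    infixr 0 _⇀_
    _⇀_ : Set → Set → Set
    A ⇀ B = A → ∂ B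

    infix 4 _≡⇀_
    _≡⇀_ : {A B : Set} → A ⇀ B → A ⇀ B → Set
    f ≡⇀ g = ∀ x b → f x ▹ b ⇔ g x ▹ b

  EPF : Partiality → Set
  EPF part = Σ (ℕ → (ℕ ⇀ ℕ)) λ e → (f : ℕ ⇀ ℕ) → ∃ λ n → e n ≡⇀ f
    where open Partiality part

  infix 4 _≡ran_
  _≡ran_ : (f g : ℕ → Maybe ℕ) → Set
  f ≡ran g = ∀ x → (∃ λ n → f n ≡ just x) ⇔ (∃ λ n → g n ≡ just x)

  EA : Set
  EA = Σ (ℕ → (ℕ → Maybe ℕ)) λ φ → (f : ℕ → Maybe ℕ) → ∃ λ c → φ c ≡ran f

{-# OPTIONS --safe #-}
-- A function f : ℕ → Maybe ℕ is a partial function ℕ ⇀ ℕ with the same range,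
-- so e already enumerates, up to range equivalence, all enumerators.  To make
-- e c total without changing its range, dovetail: at the step coding (x , k),
-- run e c x for k steps.
module Submission where

open import Defs

open import Data.Empty using (⊥-elim)
open import Data.Maybe using (Maybe; just; nothing; maybe′)
open import Data.Nat using (ℕ; zero; suc; _+_)
open import Data.Nat.Properties using (+-identityʳ; +-suc)
open import Data.Product using (∃-syntax; _×_; _,_; proj₁; proj₂; uncurry)
open import Function.Bundles using (_⇔_; mk⇔; Equivalence)
open import Function.Definitions using (StrictlySurjective)
open import Relation.Binary.PropositionalEquality
  using (_≡_; refl; sym; trans; cong; cong₂)

-- Cantor's walk: each antidiagonal x + y = s is traversed from (s , 0) to (0 , s), then the next
-- one begins.
next : ℕ × ℕ → ℕ × ℕ
next (zero  , y) = suc y , zero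
next (suc x , y) = x , suc y

unpair : ℕ → ℕ × ℕ
unpair zero    = zero , zero
unpair (suc n) = next (unpair n)

-- A first component of the form `d + x` keeps the next `d` steps on the same antidiagonal.
unpair-along-diagonal : ∀ d {x y n} → unpair n ≡ (d + x , y) →
                        unpair (d + n) ≡ (x , d + y)
unpair-along-diagonal zero    eq = eq
unpair-along-diagonal (suc d) {x} {y} eq =
  cong next (unpair-along-diagonal d (trans eq (cong (_, y) (sym (+-suc d x)))))

unpair-hits-axis : ∀ s → ∃[ n ] unpair n ≡ (s , 0)
unpair-hits-axis zero    = 0 , refl
unpair-hits-axis (suc s) with n , eq ← unpair-hits-axis s =
  -- From (s , 0), `s` steps reach (0 , s); one more jumps to (suc s , 0).
  suc (s + n) ,
  trans (cong next (unpair-along-diagonal s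
          (trans eq (cong (_, 0) (sym (+-identityʳ s))))))
        (cong (λ y → suc y , 0) (+-identityʳ s))

unpair-surjective : StrictlySurjective _≡_ unpair
unpair-surjective (x , y) with n , eq ← unpair-hits-axis (y + x) =
  -- The pair (x , y) comes `y` steps after the start (y + x , 0) of its antidiagonal.
  y + n , trans (unpair-along-diagonal y eq) (cong (x ,_) (+-identityʳ y))

module _ (𝓟 : Propositions) (part : Partiality 𝓟) where
  open Propositions 𝓟
  open Partiality part
  open Equivalence

  fromMaybe : {A : Set} → Maybe A → ∂ A
  fromMaybe = maybe′ ret undef

  fromMaybe-▹ : {A : Set} (m : Maybe A) {a : A} → fromMaybe m ▹ a ⇔ m ≡ just a
  fromMaybe-▹ (just b) = mk⇔ (λ p → cong just (▹-functional ret-▹ p)) λ { refl → ret-▹ }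
  fromMaybe-▹ nothing  = mk⇔ (λ p → ⊥-elim (undef-▹ (∃-intro _ p))) λ ()

  dovetail : {A : Set} → (ℕ ⇀ A) → ℕ → Maybe A
  dovetail g n = uncurry (λ x → seval (g x)) (unpair n)

  -- Both directions eliminate `∃` only into another `∃`, so no step bound is ever extracted as
  -- data.
  dovetail-range : {A : Set} (g : ℕ ⇀ A) {a : A} →
                   (∃ λ n → dovetail g n ≡ just a) ⇔ (∃ λ x → g x ▹ a)
  dovetail-range g {a} = mk⇔
    (∃-elim ∃-prop λ n p →
      ∃-intro (proj₁ (unpair n)) (from seval-▹ (∃-intro (proj₂ (unpair n)) p)))
    (∃-elim ∃-prop λ x p → ∃-elim ∃-prop (atStep x) (to seval-▹ p))
    where
    atStep : ∀ x k → seval (g x) k ≡ just a → ∃ λ n → dovetail g n ≡ just a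
    atStep x k p with n , eq ← unpair-surjective (x , k) =
      ∃-intro n (trans (cong (uncurry (λ x → seval (g x))) eq) p)

  ∃-map : {A : Set} {P Q : A → Set} → (∀ x → P x → Q x) → ∃ P → ∃ Q
  ∃-map f = ∃-elim ∃-prop λ x p → ∃-intro x (f x p)

theorem10 : (𝓟 : Propositions) (part : Partiality 𝓟) → EPF 𝓟 part → EA 𝓟
theorem10 𝓟 part (e , e-universal) =
  -- The enumeration is data and uses only `e` and `seval`; the merely existing code of `f` enters
  -- only the proof below.
  (λ c → dovetail 𝓟 part (e c)) ,
  λ f → ∃-map 𝓟 part
    (λ c ec≡f y → mk⇔
      (λ p → ∃-map 𝓟 part (λ x q → to (fromMaybe-▹ 𝓟 part (f x)) (to (ec≡f x y) q))
               (to (dovetail-range 𝓟 part (e c)) p))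
      (λ p → from (dovetail-range 𝓟 part (e c))
               (∃-map 𝓟 part (λ x q → from (ec≡f x y) (from (fromMaybe-▹ 𝓟 part (f x)) q)) p)))
    -- The code `c` is that of `f` made partial, undefined where `f` gives `nothing`.
    (e-universal (λ x → fromMaybe 𝓟 part (f x)))
  where
  open Propositions 𝓟
  open Equivalence
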